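{- For every fixed monotone forest $F$, $sat_m(n,e_0+F)=O(1)$.
   Context: An edge-ordered graph is a finite simple graph together with a linear order on its edge set (usually given by an injective labeling $l:E\to\mathbb{N}$ or $l:E\to\mathbb{R}$). An edge-ordered graph $H$ contains $G$ (has a copy of $G$) if $G$ is isomorphic, by an isomorphism respecting the edge-order, to a subgraph of $H$ with the induced order; otherwise $H$ is $G$-free. $l(F_1)<l(F_2)$ means that all labels of edges of $F_1$ are smaller than all labels of edges of $F_2$. A monotone forest is an edge-ordered graph $F=\sum_{i=1}^k T_i$ that is the vertex-disjoint union of edge-ordered trees $T_1,\dots,T_k$ with $l(T_i)<l(T_j)$ for all $1\le i<j\le k$. For an edge-ordered graph $G$, $e_0+G$ denotes the edge-ordered graph obtained from $G$ by adding a vertex-disjoint (isolated) edge $e_0$ whose label is smaller than all labels of $G$. $sat_m(n,G)$ is the minimum number of edges in a $G$-free edge-ordered graph $H$ on $n$ vertices such that adding to $H$ any missing edge, inserted at the beginning of the linear order (i.e. with a label smaller than all labels of $H$), creates a copy of $G$. Asymptotic notation is for $n\to\infty$ with $F$ fixed. -}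

module Defs where

open import Data.Fin using (Fin; zero; suc; _<_; _↑ˡ_; _↑ʳ_; splitAt)
open import Data.Fin.Properties
  using (toℕ-↑ˡ; toℕ-↑ʳ; ↑ˡ-injective; ↑ʳ-injective; splitAt-↑ˡ; splitAt-↑ʳ)
open import Data.List using (List; []; _∷_; _++_; _∷ʳ_; map; length; sum)
open import Data.List.Membership.Propositional using (_∈_; _∉_)
open import Data.List.Membership.Propositional.Properties using (∈-map⁻)
open import Data.List.Relation.Binary.Pointwise using (Pointwise)
open import Data.List.Relation.Binary.Sublist.Heterogeneous using (Sublist)
open import Data.List.Relation.Unary.All using (All; []; _∷_)
import Data.List.Relation.Unary.All as All
import Data.List.Relation.Unary.All.Properties as All
open import Data.List.Relation.Unary.AllPairs using ([]; _∷_)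
open import Data.List.Relation.Unary.Linked using (Linked)
open import Data.List.Relation.Unary.Unique.Propositional using (Unique)
import Data.List.Relation.Unary.Unique.Propositional.Properties as Unique
open import Data.Nat as ℕ using (ℕ; _+_; _≤_; z≤n; s≤s)
open import Data.Nat.Properties using (+-monoʳ-<)
open import Data.Product using (_×_; _,_; ∃; ∃-syntax; proj₁; proj₂)
open import Data.Product.Properties using (,-injective)
open import Data.Sum using (_⊎_; inj₁; inj₂)
open import Function using (_∘_; Injective; Bijective)
open import Relation.Binary.Construct.Closure.ReflexiveTransitive using (Star)
open import Relation.Binary.PropositionalEquality
  using (_≡_; refl; sym; trans; cong; cong₂; subst₂)
open import Relation.Nullary using (¬_)

private
  variable
    m n : ℕ

-- The unordered pair {i , j} of distinct vertices is represented by the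
-- pair (i , j) with i < j.
Ordered : Fin n × Fin n → Set
Ordered (i , j) = i < j

-- The linear order on the edge set is the order of the list: an earlier
-- edge has a smaller label.
record EdgeOrderedGraph (n : ℕ) : Set where
  constructor mkGraph
  field
    edges   : List (Fin n × Fin n)
    ordered : All Ordered edges
    unique  : Unique edges

  size : ℕ
  size = length edges

  Adjacent : Fin n → Fin n → Set
  Adjacent i j = (i , j) ∈ edges ⊎ (j , i) ∈ edges

open EdgeOrderedGraph public

∅ : EdgeOrderedGraph 0
∅ = mkGraph [] [] []

K₂ : EdgeOrderedGraph 2
K₂ = mkGraph ((zero , suc zero) ∷ []) (s≤s z≤n ∷ []) ([] ∷ [])

addFirst : (H : EdgeOrderedGraph n) (e : Fin n × Fin n) →
           Ordered e → e ∉ edges H → EdgeOrderedGraph n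
addFirst H e e< e∉ = mkGraph (e ∷ edges H) (e< ∷ ordered H)
  (All.¬Any⇒All¬ (edges H) e∉ ∷ unique H)

injˡ : ∀ n → Fin m × Fin m → Fin (m + n) × Fin (m + n)
injˡ n (i , j) = i ↑ˡ n , j ↑ˡ n

injʳ : ∀ m → Fin n × Fin n → Fin (m + n) × Fin (m + n)
injʳ m (i , j) = m ↑ʳ i , m ↑ʳ j

infixr 6 _⊕_

-- Vertex-disjoint union G ⊕ H with l(G) < l(H).
_⊕_ : EdgeOrderedGraph m → EdgeOrderedGraph n → EdgeOrderedGraph (m + n)
_⊕_ {m} {n} G H = mkGraph
  (map (injˡ n) (edges G) ++ map (injʳ m) (edges H))
  (All.++⁺
    (All.map⁺ (All.map (λ {e} → ordˡ e) (ordered G)))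
    (All.map⁺ (All.map (λ {e} → ordʳ e) (ordered H))))
  (Unique.++⁺
    (Unique.map⁺ (λ eq → let p , q = ,-injective eq in
      cong₂ _,_ (↑ˡ-injective n _ _ p) (↑ˡ-injective n _ _ q)) (unique G))
    (Unique.map⁺ (λ eq → let p , q = ,-injective eq in
      cong₂ _,_ (↑ʳ-injective m _ _ p) (↑ʳ-injective m _ _ q)) (unique H))
    disjoint)
  where
  ordˡ : ∀ e → Ordered e → Ordered (injˡ n e)
  ordˡ (i , j) = subst₂ ℕ._<_ (sym (toℕ-↑ˡ i n)) (sym (toℕ-↑ˡ j n))

  ordʳ : ∀ e → Ordered e → Ordered (injʳ m e)
  ordʳ (i , j) i<j = subst₂ ℕ._<_ (sym (toℕ-↑ʳ m i)) (sym (toℕ-↑ʳ m j))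
    (+-monoʳ-< m i<j)

  ↑ˡ≢↑ʳ : ∀ i j → ¬ (i ↑ˡ n ≡ m ↑ʳ j)
  ↑ˡ≢↑ʳ i j eq with trans (sym (splitAt-↑ˡ m i n))
    (trans (cong (splitAt m) eq) (splitAt-↑ʳ m n j))
  ... | ()

  disjoint : ∀ {e} → ¬ (e ∈ map (injˡ n) (edges G) × e ∈ map (injʳ m) (edges H))
  disjoint (p , q) with ∈-map⁻ (injˡ n) p | ∈-map⁻ (injʳ m) q
  ... | (i , _) , _ , refl | (j , _) , _ , eq = ↑ˡ≢↑ʳ i j (cong proj₁ eq)

infixr 6 e₀+_

e₀+_ : EdgeOrderedGraph n → EdgeOrderedGraph (2 + n)
e₀+ G = K₂ ⊕ G

⨁ : (Ts : List (∃ EdgeOrderedGraph)) → EdgeOrderedGraph (sum (map proj₁ Ts))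
⨁ []             = ∅
⨁ ((_ , T) ∷ Ts) = T ⊕ ⨁ Ts

-- e′ is the image of the edge e under f, as unordered pairs.
ImageOf : (Fin m → Fin n) → Fin m × Fin m → Fin n × Fin n → Set
ImageOf f (i , j) e′ = e′ ≡ (f i , f j) ⊎ e′ ≡ (f j , f i)

infix 4 _≅_

_≅_ : EdgeOrderedGraph m → EdgeOrderedGraph n → Set
G ≅ H = ∃[ f ] Bijective _≡_ _≡_ f × Pointwise (ImageOf f) (edges G) (edges H)

-- A subgraph with the induced edge-order is a sublist of the edge list
-- (together with a set of vertices, here the image of f).
Contains : EdgeOrderedGraph n → EdgeOrderedGraph m → Set
Contains H G =
  ∃[ f ] Injective _≡_ _≡_ f × Sublist (ImageOf f) (edges G) (edges H)

Connected : EdgeOrderedGraph n → Set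
Connected G = ∀ i j → Star (Adjacent G) i j

-- The closed walk x , y , zs , w , x; distinctness of the vertices makes it
-- a cycle of length at least 3.
record Cycle (G : EdgeOrderedGraph n) : Set where
  field
    x y w    : Fin n
    zs       : List (Fin n)
    distinct : Unique (x ∷ y ∷ zs ∷ʳ w)
    path     : Linked (Adjacent G) (x ∷ y ∷ zs ∷ʳ w)
    closing  : Adjacent G w x

record IsTree (G : EdgeOrderedGraph n) : Set where
  field
    nonempty  : 0 ℕ.< n
    connected : Connected G
    acyclic   : ¬ Cycle G

IsMonotoneForest : EdgeOrderedGraph n → Set
IsMonotoneForest F = ∃[ Ts ] All (IsTree ∘ proj₂) Ts × F ≅ ⨁ Ts

record MonotoneSaturated (G : EdgeOrderedGraph m) (H : EdgeOrderedGraph n) : Set where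
  field
    free      : ¬ Contains H G
    saturated : ∀ e (e< : Ordered e) (e∉ : e ∉ edges H) →
                Contains (addFirst H e e< e∉) G

-- The relation "satₘ(n , G) = s".  It is a relation because for some G
-- (such as edgeless G and large n) there is no saturated graph, so that the
-- minimum is undefined.
record Satₘ (n : ℕ) (G : EdgeOrderedGraph m) (s : ℕ) : Set where
  field
    attained : ∃[ H ] MonotoneSaturated {n = n} G H × size H ≡ s
    minimal  : ∀ (H : EdgeOrderedGraph n) → MonotoneSaturated G H → s ≤ size H

-- A = O(1) as n → ∞ for a quantity A given by its graph ("A(n) = s"); this
-- includes that A(n) is defined for all large n.
_isO[1] : (ℕ → ℕ → Set) → Set
A isO[1] = ∃[ C ] ∃[ N ] (∀ n → N ≤ n → ∃[ s ] A n s × s ≤ C)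

{-# OPTIONS --safe #-}

-- For a single tree T with first edge xy, take three copies of the contracted
-- tree T / xy, with the three versions of each edge consecutive in the edge
-- order, and precede them by a triangle on the three contracted vertices.  An
-- edge of the triangle completes a copy of T (it plays xy, and the two sides
-- of T − xy go to the two copies it joins) which avoids the third contracted
-- tree; so every vertex is avoided by a copy of T.  On the other hand a
-- contracted tree has too few edges for T, and any two edges of the triangle
-- meet, so the graph contains no e₀+T.  Both properties pass from the trees to
-- F: the ordered sum H of these gadgets is (e₀+F)-free, and every vertex of H
-- is avoided by a copy of F in H.  After adding isolated
-- vertices to H, any edge with an end outside H creates a copy of e₀+F, so that
-- greedily adding edges within H gives a saturated graph of size O(1).
module Submission where

open import Data.Bool using (Bool; true; false; _∨_; _∧_; if_then_else_)
open import Data.Fin using (Fin; zero; suc; _<_; _↑ˡ_; _↑ʳ_; splitAt; join; combine; fromℕ<)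
open import Data.Fin.Patterns using (0F; 1F; 2F)
open import Data.Fin.Properties as Fin
  using (_≟_; _<?_; ↑ˡ-injective; ↑ʳ-injective; splitAt-↑ˡ; splitAt-↑ʳ; join-splitAt;
         combine-injective; combine-injectiveˡ; combine-injectiveʳ; combine-surjective;
         combine-monoˡ-<)
open import Data.List
  using (List; []; _∷_; _++_; map; length; allFin; cartesianProduct)
open import Data.List.Membership.Propositional using (_∈_; _∉_; find)
open import Data.List.Membership.Propositional.Properties
  using (∈-map⁺; ∈-map⁻; ∈-++⁻; ∈-allFin; ∈-cartesianProduct⁺; ∈-cartesianProduct⁻)
import Data.List.Membership.DecPropositional as DecMembership
open import Data.List.Properties using (map-∘; map-++; length-map; ++-identityʳ)
open import Data.List.Relation.Binary.Pointwise using (Pointwise; []; _∷_)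
open import Data.List.Relation.Binary.Sublist.Heterogeneous as Sublist
  using (Sublist; []; _∷ʳ_; _∷_; minimum)
import Data.List.Relation.Binary.Sublist.Heterogeneous.Properties as Sublist
open import Data.List.Relation.Unary.All as All using (All; []; _∷_)
import Data.List.Relation.Unary.All.Properties as All
open import Data.List.Relation.Unary.AllPairs using ([]; _∷_)
open import Data.List.Relation.Unary.Any as Any using (Any; here; there)
open import Data.List.Relation.Unary.Linked as Linked using (Linked; [-]; _∷_)
open import Data.List.Relation.Unary.Unique.Propositional using (Unique)
import Data.List.Relation.Unary.Unique.Propositional.Properties as Unique
import Data.List.Relation.Unary.Unique.DecPropositional as DecUnique
open import Data.Nat as ℕ using (ℕ; _+_; _*_; _≤_; z≤n; s≤s)
open import Data.Nat.ListAction using (sum)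
import Data.Nat.Properties as ℕ
open import Data.Product using (Σ-syntax; _×_; _,_; ∃; ∃-syntax; proj₁; proj₂)
open import Data.Product.Properties using (≡-dec)
open import Data.Sum as Sum using (_⊎_; inj₁; inj₂)
open import Data.Unit using (⊤; tt)
open import Data.Vec using (Vec; []; _∷_; lookup; tabulate; toList; fromList)
open import Data.Vec.Properties using (lookup∘tabulate; toList∘fromList; length-toList)
open import Function using (_∘_; Injective; case_of_)
open import Relation.Binary.Construct.Closure.ReflexiveTransitive as Star
  using (Star; ε; _◅_; _◅◅_)
open import Relation.Binary.Definitions using (DecidableEquality)
open import Relation.Binary.PropositionalEquality
  using (_≡_; _≢_; refl; sym; trans; cong; cong₂; subst; subst₂)
open import Relation.Nullary using (¬_; Dec; yes; no; contradiction)
open import Relation.Nullary.Decidable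
  using (does; dec-true; dec-false; map′; _×-dec_; _⊎-dec_; _→-dec_; ¬?)
open import Relation.Unary using (Decidable)
open import Defs

private
  variable
    a b k m n v w : ℕ

-- Bridges and cycles

Edge : ℕ → Set
Edge n = Fin n × Fin n

Adj : List (Edge n) → Fin n → Fin n → Set
Adj E i j = (i , j) ∈ E ⊎ (j , i) ∈ E

Separates : List (Edge n) → (Fin n → Bool) → Set
Separates E s = All (λ (i , j) → s i ≡ s j) E

-- Induction on the edge list: a separation for the old edges can fail only if the new edge crosses
-- it. The separating function later serves as the two sides of a tree without its first edge.
connected-or-separated : (E : List (Edge n)) (x y : Fin n) →
  Star (Adj E) x y ⊎ (∃[ s ] Separates E s × s x ≡ false × s y ≡ true)
connected-or-separated [] x y with x ≟ y
... | yes refl = inj₁ ε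
... | no x≢y   =
  inj₂ ((λ z → does (z ≟ y)) , [] , dec-false (x ≟ y) x≢y , dec-true (y ≟ y) refl)
connected-or-separated {n} ((a , b) ∷ E) x y with connected-or-separated E x y
... | inj₁ x~y = inj₁ (Star.map (Sum.map there there) x~y)
... | inj₂ (s , sep , sx , sy) = bridge (s a) (s b) refl refl
  where
  E⁺ : List (Edge n)
  E⁺ = (a , b) ∷ E

  lift : ∀ {i j} → Star (Adj E) i j → Star (Adj E⁺) i j
  lift = Star.map (Sum.map there there)

  -- Here the new edge c d leaves the side of x.  Unless x ~ c and d ~ y,
  -- moving c across or d back restores a separation.
  cross : ∀ {c d} → s c ≡ false → s d ≡ true → Adj E⁺ c d →
    (∀ t → t c ≡ t d → t a ≡ t b) →
    Star (Adj E⁺) x y ⊎ (∃[ t ] Separates E⁺ t × t x ≡ false × t y ≡ true)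
  cross {c} {d} sc sd cd transfer
    with connected-or-separated E x c | connected-or-separated E d y
  ... | inj₁ x~c | inj₁ d~y = inj₁ (lift x~c ◅◅ cd ◅ lift d~y)
  ... | inj₂ (t , sep′ , tx , tc) | _ =
    inj₂ (u , transfer u (trans (cong₂ _∨_ sc tc) (sym (cong (_∨ t d) sd)))
            ∷ All.zipWith (λ (p , q) → cong₂ _∨_ p q) (sep , sep′)
         , cong₂ _∨_ sx tx , cong (_∨ t y) sy)
    where
    u : Fin n → Bool
    u z = s z ∨ t z
  ... | inj₁ _ | inj₂ (t , sep′ , td , ty) =
    inj₂ (u , transfer u (trans (cong (_∧ t c) sc) (sym (cong₂ _∧_ sd td)))
            ∷ All.zipWith (λ (p , q) → cong₂ _∧_ p q) (sep , sep′)
         , cong (_∧ t x) sx , cong₂ _∧_ sy ty)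
    where
    u : Fin n → Bool
    u z = s z ∧ t z

  bridge : ∀ p q → s a ≡ p → s b ≡ q →
    Star (Adj E⁺) x y ⊎ (∃[ t ] Separates E⁺ t × t x ≡ false × t y ≡ true)
  bridge false false sa sb = inj₂ (s , trans sa (sym sb) ∷ sep , sx , sy)
  bridge true  true  sa sb = inj₂ (s , trans sa (sym sb) ∷ sep , sx , sy)
  bridge false true  sa sb = cross sa sb (inj₁ (here refl)) (λ _ eq → eq)
  bridge true  false sa sb = cross sb sa (inj₂ (here refl)) (λ _ eq → sym eq)

data Path (R : Fin n → Fin n → Set) : Fin n → Fin n → List (Fin n) → Set where
  [_] : ∀ i → Path R i i (i ∷ [])
  _∷_ : ∀ {i j l ps} → R i j → Path R j l ps → Path R i l (i ∷ ps)

module _ {R : Fin n → Fin n → Set} where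

  suffix-from : ∀ {i j l ps} → i ∈ ps → Path R j l ps → Unique ps →
    ∃[ qs ] Path R i l qs × Unique qs
  suffix-from (here refl) p@([ _ ]) u = _ , p , u
  suffix-from (here refl) p@(_ ∷ _) u = _ , p , u
  suffix-from (there i∈) (_ ∷ p) (_ ∷ u) = suffix-from i∈ p u

  -- If the vertex to be prepended already occurs, the loop is cut off by passing to the suffix that
  -- starts at it.
  simplePath : ∀ {i j} → Star R i j → ∃[ ps ] Path R i j ps × Unique ps
  simplePath ε = _ , [ _ ] , [] ∷ []
  simplePath {i} (r ◅ rs) with simplePath rs
  ... | ps , p , u with i ∈? ps
    where open DecMembership (_≟_ {n}) using (_∈?_)
  ... | yes i∈ = suffix-from i∈ p u
  ... | no i∉  = _ , r ∷ p , All.¬Any⇒All¬ ps i∉ ∷ u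

  Path⇒Linked : ∀ {i j ps} → Path R i j ps → Linked R ps
  Path⇒Linked [ _ ]             = [-]
  Path⇒Linked (r ∷ [ _ ])       = r ∷ [-]
  Path⇒Linked (r ∷ p@(_ ∷ _))   = r ∷ Path⇒Linked p

  Path-last : ∀ {i j ps} → Path R i j ps → ∃[ qs ] ps ≡ qs ++ j ∷ []
  Path-last [ _ ] = [] , refl
  Path-last (_∷_ {i = i} r p) with Path-last p
  ... | qs , refl = i ∷ qs , refl

-- A simple path from `x` to `y` in `E` with at least two edges is closed to a cycle by `e`. Shorter
-- ones are impossible: `x` and `y` differ, and `E` contains `e` in neither orientation.
acyclic⇒bridge : ∀ {e : Edge n} {E e<ord uniq} →
  ¬ Cycle (mkGraph (e ∷ E) e<ord uniq) → ¬ Star (Adj E) (proj₁ e) (proj₂ e)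
acyclic⇒bridge {e = x , y} {E} {x<y ∷ ord} {e∉ ∷ _} ¬cycle x~y
  with simplePath x~y
... | _ , [ _ ] , _ = Fin.<-irrefl refl x<y
... | _ , (inj₁ xy∈ ∷ [ _ ]) , _ = All.All¬⇒¬Any e∉ xy∈
... | _ , (inj₂ yx∈ ∷ [ _ ]) , _ = Fin.<-asym x<y (All.lookup ord yx∈)
... | _ , path@(_ ∷ (_ ∷ p)) , u with Path-last p
... | zs , refl = ¬cycle record
  { zs = zs
  ; distinct = u
  ; path = Linked.map (Sum.map there there) (Path⇒Linked path)
  ; closing = inj₂ (here refl)
  }

-- Gadgets and their ordered sums

Inj : (Fin m → Fin n) → Set
Inj = Injective _≡_ _≡_

on : (Fin m → Fin n) → Edge m → Edge n
on f (i , j) = f i , f j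

-- Sublists and images of edges

module _ {A B : Set} {R : A → B → Set} where

  ++-dropˡ : ∀ xs {ys zs} → Sublist R (xs ++ ys) zs → Sublist R ys zs
  ++-dropˡ []       s = s
  ++-dropˡ (_ ∷ xs) s = ++-dropˡ xs (Sublist.∷ˡ⁻ s)

  ++-takeˡ : ∀ xs {ys zs} → Sublist R (xs ++ ys) zs → Sublist R xs zs
  ++-takeˡ []       s        = minimum _
  ++-takeˡ (x ∷ xs) (y ∷ʳ s) = y ∷ʳ ++-takeˡ (x ∷ xs) s
  ++-takeˡ (x ∷ xs) (r ∷ s)  = r ∷ ++-takeˡ xs s

  lookup∈ : ∀ {x xs ys} → x ∈ xs → Sublist R xs ys → Any (R x) ys
  lookup∈ x∈ (_ ∷ʳ s)       = there (lookup∈ x∈ s)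
  lookup∈ (here refl) (r ∷ _) = here r
  lookup∈ (there x∈) (_ ∷ s)  = there (lookup∈ x∈ s)

  -- Matching preserves the order: when the first element has no partner in `ys`, its successors are
  -- matched beyond `ys` as well.
  cancelˡ : ∀ {x xs} ys {zs} → (∀ {y} → y ∈ ys → ¬ R x y) →
    Sublist R (x ∷ xs) (ys ++ zs) → Sublist R (x ∷ xs) zs
  cancelˡ []       _  s        = s
  cancelˡ (_ ∷ ys) ¬r (_ ∷ʳ s) = cancelˡ ys (¬r ∘ there) s
  cancelˡ (_ ∷ ys) ¬r (r ∷ _)  = contradiction r (¬r (here refl))

  cancelʳ : ∀ {xs} ys {zs} → (∀ {x z} → x ∈ xs → z ∈ zs → ¬ R x z) →
    Sublist R xs (ys ++ zs) → Sublist R xs ys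
  cancelʳ {[]}    _        _  _ = minimum _
  cancelʳ {_ ∷ _} []       ¬r s with find (lookup∈ (here refl) s)
  ... | _ , z∈ , r = contradiction r (¬r (here refl) z∈)
  cancelʳ {_ ∷ _} (y ∷ ys) ¬r (_ ∷ʳ s) = y ∷ʳ cancelʳ ys ¬r s
  cancelʳ {_ ∷ _} (y ∷ ys) ¬r (r ∷ s)  = r ∷ cancelʳ ys (¬r ∘ there) s

map⁻ˡ : ∀ {A B C : Set} {R : B → C → Set} {f : A → B} xs {ys} →
  Sublist R (map f xs) ys → Sublist (R ∘ f) xs ys
map⁻ˡ []       _        = minimum _
map⁻ˡ (x ∷ xs) (y ∷ʳ s) = y ∷ʳ map⁻ˡ (x ∷ xs) s
map⁻ˡ (_ ∷ xs) (r ∷ s)  = r ∷ map⁻ˡ xs s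

image-head : ∀ {f : Fin m → Fin n} {e e′} → ImageOf f e e′ → ∃[ i ] f i ≡ proj₁ e′
image-head (inj₁ refl) = _ , refl
image-head (inj₂ refl) = _ , refl

image-tail : ∀ {f : Fin m → Fin n} {e e′} → ImageOf f e e′ → ∃[ i ] f i ≡ proj₂ e′
image-tail (inj₁ refl) = _ , refl
image-tail (inj₂ refl) = _ , refl

image-on : ∀ {f : Fin m → Fin n} {e e′} (g : Fin n → Fin k) →
  ImageOf f e e′ → ImageOf (g ∘ f) e (on g e′)
image-on {f = f} {e} {e′} g = Sum.map (cong (on g)) (cong (on g))

Sublist-on : ∀ {f : Fin m → Fin n} {E L} (g : Fin n → Fin k) →
  Sublist (ImageOf f) E L → Sublist (ImageOf (g ∘ f)) E (map (on g) L)
Sublist-on g []       = []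
Sublist-on g (y ∷ʳ s) = on g y ∷ʳ Sublist-on g s
Sublist-on {f = f} g (r ∷ s)  = image-on {f = f} g r ∷ Sublist-on g s

-- Q is a union of connected components of L.
Closed : List (Edge n) → (Fin n → Set) → Set
Closed L Q = ∀ {e} → e ∈ L → (Q (proj₁ e) → Q (proj₂ e)) × (Q (proj₂ e) → Q (proj₁ e))

-- Each edge of `E` has its image in `L`, so the image of a walk in `E` cannot leave a union of
-- components of `L`.
spread : ∀ {E : List (Edge m)} {L : List (Edge n)} {Q f} → Closed L Q →
  Sublist (ImageOf f) E L → ∀ {i j} → Star (Adj E) i j → Q (f i) → Q (f j)
spread {E = E} {L} {Q} {f} closed s = go
  where
  along : ∀ {i j} → (i , j) ∈ E → (Q (f i) → Q (f j)) × (Q (f j) → Q (f i))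
  along ij∈ with find (lookup∈ ij∈ s)
  ... | _ , e∈ , inj₁ refl = closed e∈
  ... | _ , e∈ , inj₂ refl = proj₂ (closed e∈) , proj₁ (closed e∈)

  go : ∀ {i j} → Star (Adj E) i j → Q (f i) → Q (f j)
  go ε q = q
  go (inj₁ ij∈ ◅ w) q = go w (proj₁ (along ij∈) q)
  go (inj₂ ji∈ ◅ w) q = go w (proj₂ (along ji∈) q)

-- No edge of L, followed by a disjoint copy of E among the later edges, is a
-- copy of e₀+E.  Quantifying over the vertex embedding ι makes the property
-- independent of the vertex set in which L lives.
Blocked : List (Edge v) → List (Edge a) → Set
Blocked E [] = ⊤
Blocked {v} {a} E ((x , y) ∷ L) =
  (∀ {n} {ι : Fin a → Fin n} {f : Fin v → Fin n} → Inj ι → Inj f →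
    (∀ i → f i ≢ ι x) → (∀ i → f i ≢ ι y) →
    ¬ Sublist (ImageOf f) E (map (on ι) L))
  × Blocked E L

-- The image of `(x , y)` plays e₀ and the copy of `E` comes after it. The edges `xs` in between are
-- dropped; they make room for the remaining edges of a tree that precedes `E`.
blocked⇒¬copy : {E : List (Edge v)} (L : List (Edge a)) → Blocked E L →
  {ι : Fin a → Fin n} {g : Fin w → Fin n} {h : Fin v → Fin w} →
  Inj ι → Inj g → Inj h →
  ∀ {x y} xs → (∀ i → h i ≢ x) → (∀ i → h i ≢ y) →
  ¬ Sublist (ImageOf g) ((x , y) ∷ xs ++ map (on h) E) (map (on ι) L)
blocked⇒¬copy (_ ∷ L) (_ , bl) ι-inj g-inj h-inj xs h≢x h≢y (_ ∷ʳ s) =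
  blocked⇒¬copy L bl ι-inj g-inj h-inj xs h≢x h≢y s
blocked⇒¬copy {E = E} (_ ∷ L) (b , _) {ι} {g} {h} ι-inj g-inj h-inj xs h≢x h≢y (r ∷ s) =
  b ι-inj (h-inj ∘ g-inj) (λ i → avoid₁ r i) (λ i → avoid₂ r i) (map⁻ˡ E (++-dropˡ xs s))
  where
  avoid₁ : ∀ {p} → ImageOf g _ p → ∀ i → g (h i) ≢ proj₁ p
  avoid₁ (inj₁ refl) i eq = h≢x i (g-inj eq)
  avoid₁ (inj₂ refl) i eq = h≢y i (g-inj eq)

  avoid₂ : ∀ {p} → ImageOf g _ p → ∀ i → g (h i) ≢ proj₂ p
  avoid₂ (inj₁ refl) i eq = h≢y i (g-inj eq)
  avoid₂ (inj₂ refl) i eq = h≢x i (g-inj eq)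

-- `root` ensures that there is a vertex at all, so that `avoiding` yields at least one copy.
record Gadget (E : List (Edge v)) : Set where
  field
    {order}  : ℕ
    graph    : EdgeOrderedGraph order
    root     : Fin order
    avoiding : ∀ u → ∃[ f ] Inj f × (∀ i → f i ≢ u) × Sublist (ImageOf f) E (edges graph)
    blocked  : Blocked E (edges graph)

-- Disjoint unions of embeddings

↑ˡ≢↑ʳ : (i : Fin m) (j : Fin n) → i ↑ˡ n ≢ m ↑ʳ j
↑ˡ≢↑ʳ {m} {n} i j eq with trans (sym (splitAt-↑ˡ m i n))
  (trans (cong (splitAt m) eq) (splitAt-↑ʳ m n j))
... | ()

data SplitView (m : ℕ) {n} : Fin (m + n) → Set where
  left  : ∀ i → SplitView m (i ↑ˡ n)
  right : ∀ j → SplitView m (m ↑ʳ j)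

splitView : ∀ m (i : Fin (m + n)) → SplitView m i
splitView {n} m i = subst (SplitView m) (join-splitAt m n i) (view (splitAt m i))
  where
  view : (s : Fin m ⊎ Fin n) → SplitView m (join m n s)
  view (inj₁ i) = left i
  view (inj₂ j) = right j

module _ (f : Fin m → Fin a) (g : Fin n → Fin b) where

  parallel : Fin (m + n) → Fin (a + b)
  parallel = join a b ∘ Sum.map f g ∘ splitAt m

  parallel-↑ˡ : ∀ i → parallel (i ↑ˡ n) ≡ f i ↑ˡ b
  parallel-↑ˡ i = cong (join a b ∘ Sum.map f g) (splitAt-↑ˡ m i n)

  parallel-↑ʳ : ∀ j → parallel (m ↑ʳ j) ≡ a ↑ʳ g j
  parallel-↑ʳ j = cong (join a b ∘ Sum.map f g) (splitAt-↑ʳ m n j)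

  parallel-injective : Inj f → Inj g → Inj parallel
  parallel-injective f-inj g-inj {i} {j} eq with splitView m i | splitView m j
  ... | left i | left j = cong (_↑ˡ n) (f-inj (↑ˡ-injective b _ _
    (trans (sym (parallel-↑ˡ i)) (trans eq (parallel-↑ˡ j)))))
  ... | right i | right j = cong (m ↑ʳ_) (g-inj (↑ʳ-injective a _ _
    (trans (sym (parallel-↑ʳ i)) (trans eq (parallel-↑ʳ j)))))
  ... | left i | right j = contradiction
    (trans (sym (parallel-↑ˡ i)) (trans eq (parallel-↑ʳ j))) (↑ˡ≢↑ʳ _ _)
  ... | right i | left j = contradiction
    (trans (sym (parallel-↑ˡ j)) (trans (sym eq) (parallel-↑ʳ i))) (↑ˡ≢↑ʳ _ _)

  parallel-avoidsˡ : ∀ {u} → (∀ i → f i ≢ u) → ∀ i → parallel i ≢ u ↑ˡ b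
  parallel-avoidsˡ f≢u i eq with splitView m i
  ... | left i  = f≢u i (↑ˡ-injective b _ _ (trans (sym (parallel-↑ˡ i)) eq))
  ... | right i = ↑ˡ≢↑ʳ _ _ (trans (sym eq) (parallel-↑ʳ i))

  parallel-avoidsʳ : ∀ {u} → (∀ i → g i ≢ u) → ∀ i → parallel i ≢ a ↑ʳ u
  parallel-avoidsʳ g≢u i eq with splitView m i
  ... | left i  = ↑ˡ≢↑ʳ _ _ (trans (sym (parallel-↑ˡ i)) eq)
  ... | right i = g≢u i (↑ʳ-injective a _ _ (trans (sym (parallel-↑ʳ i)) eq))

  parallel-Sublist : ∀ {E E′ L L′} → Sublist (ImageOf f) E L → Sublist (ImageOf g) E′ L′ →
    Sublist (ImageOf parallel) (map (injˡ n) E ++ map (injʳ m) E′)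
                               (map (injˡ b) L ++ map (injʳ a) L′)
  parallel-Sublist s t = Sublist.++⁺
    (Sublist.map⁺ (injˡ n) (injˡ b) (Sublist.map imageˡ s))
    (Sublist.map⁺ (injʳ m) (injʳ a) (Sublist.map imageʳ t))
    where
    imageˡ : ∀ {e e′} → ImageOf f e e′ → ImageOf parallel (injˡ n e) (injˡ b e′)
    imageˡ {i , j} = Sum.map
      (λ { refl → sym (cong₂ _,_ (parallel-↑ˡ i) (parallel-↑ˡ j)) })
      (λ { refl → sym (cong₂ _,_ (parallel-↑ˡ j) (parallel-↑ˡ i)) })

    imageʳ : ∀ {e e′} → ImageOf g e e′ → ImageOf parallel (injʳ m e) (injʳ a e′)
    imageʳ {i , j} = Sum.map
      (λ { refl → sym (cong₂ _,_ (parallel-↑ʳ i) (parallel-↑ʳ j)) })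
      (λ { refl → sym (cong₂ _,_ (parallel-↑ʳ j) (parallel-↑ʳ i)) })

map-injˡ : (ι : Fin (a + b) → Fin k) → ∀ L →
  map (on ι) (map (injˡ b) L) ≡ map (on (ι ∘ (_↑ˡ b))) L
map-injˡ _ L = sym (map-∘ L)

map-injʳ : (ι : Fin (a + b) → Fin k) → ∀ L →
  map (on ι) (map (injʳ a) L) ≡ map (on (ι ∘ (a ↑ʳ_))) L
map-injʳ _ L = sym (map-∘ L)

module _ {E : List (Edge m)} {E′ : List (Edge n)} where

  private
    E⊕E′ : List (Edge (m + n))
    E⊕E′ = map (injˡ n) E ++ map (injʳ m) E′

  blocked-↑ʳ : (L′ : List (Edge b)) → Blocked E′ L′ → Blocked E⊕E′ (map (injʳ a) L′)
  blocked-↑ʳ []       _        = tt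
  blocked-↑ʳ {a = a} (_ ∷ L′) (blk , bl) =
    (λ {k} {ι} {f} ι-inj f-inj f≢x f≢y s → blk
      (↑ʳ-injective a _ _ ∘ ι-inj) (↑ʳ-injective m _ _ ∘ f-inj)
      (λ i → f≢x (m ↑ʳ i)) (λ i → f≢y (m ↑ʳ i))
      (map⁻ˡ E′ (subst (Sublist (ImageOf f) (map (injʳ m) E′)) (map-injʳ ι L′)
        (++-dropˡ (map (injˡ n) E) s)))) ,
    blocked-↑ʳ L′ bl

closed-↑ˡ : {ι : Fin (a + b) → Fin k} → Inj ι → ∀ (L : List (Edge a)) (L′ : List (Edge b)) →
  Closed (map (on ι) (map (injˡ b) L) ++ map (on ι) (map (injʳ a) L′))
         (λ u → ∃[ i ] u ≡ ι (i ↑ˡ b))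
closed-↑ˡ {a} {b} {ι = ι} ι-inj L L′ e∈ with ∈-++⁻ (map (on ι) (map (injˡ b) L)) e∈
... | inj₁ e∈ˡ with ∈-map⁻ (on ι) e∈ˡ
...   | _ , e∈ˡ , refl with ∈-map⁻ (injˡ b) e∈ˡ
...     | _ , _ , refl = (λ _ → _ , refl) , (λ _ → _ , refl)
closed-↑ˡ {a} {b} {ι = ι} ι-inj L L′ e∈ | inj₂ e∈ʳ with ∈-map⁻ (on ι) e∈ʳ
...   | _ , e∈ʳ , refl with ∈-map⁻ (injʳ a) e∈ʳ
...     | _ , _ , refl = (λ (_ , eq) → contradiction (sym (ι-inj eq)) (↑ˡ≢↑ʳ _ _)) ,
                         (λ (_ , eq) → contradiction (sym (ι-inj eq)) (↑ˡ≢↑ʳ _ _))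

¬↑ˡ : {ι : Fin (a + b) → Fin k} → Inj ι → (L′ : List (Edge b)) →
  ∀ {e} → e ∈ map (on ι) (map (injʳ a) L′) → ¬ (∃[ i ] proj₁ e ≡ ι (i ↑ˡ b))
¬↑ˡ {a} {ι = ι} ι-inj L′ e∈ (i , eq) with ∈-map⁻ (on ι) e∈
... | _ , e∈ʳ , refl with ∈-map⁻ (injʳ a) e∈ʳ
...   | _ , _ , refl = ↑ˡ≢↑ʳ _ _ (sym (ι-inj eq))

-- A copy of E ⊕ E′ in L ⊕ L′ has its connected part E inside one of the two
-- summands.  If this is L′, then the later edges E′ are in L′ as well, and
-- the first edge of E acts as e₀.
¬copy-⊕ : ∀ {e} {E : List (Edge m)} {E′ : List (Edge n)} →
  (∀ i j → Star (Adj (e ∷ E)) i j) →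
  (L : List (Edge a)) {L′ : List (Edge b)} → Blocked E′ L′ →
  {ι : Fin (a + b) → Fin k} {f : Fin (m + n) → Fin k} → Inj ι → Inj f →
  ¬ Sublist (ImageOf (f ∘ (_↑ˡ n))) (e ∷ E) (map (on (ι ∘ (_↑ˡ b))) L) →
  ¬ Sublist (ImageOf f) (map (injˡ n) (e ∷ E) ++ map (injʳ m) E′)
                        (map (on ι) (map (injˡ b) L ++ map (injʳ a) L′))
¬copy-⊕ {m} {n} {a} {b} {k} {e} {E} {E′} conn L {L′} bl′ {ι} {f} ι-inj f-inj ¬copyˡ s =
  blocked⇒¬copy L′ bl′ (↑ʳ-injective a _ _ ∘ ι-inj) f-inj (↑ʳ-injective m _ _)
    (map (injˡ n) E) (λ i → ↑ˡ≢↑ʳ _ _ ∘ sym) (λ i → ↑ˡ≢↑ʳ _ _ ∘ sym)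
    (subst (Sublist (ImageOf f) _) (map-injʳ ι L′) (cancelˡ M not-left s′))
  where
  M : List (Edge k)
  M = map (on ι) (map (injˡ b) L)

  M′ : List (Edge k)
  M′ = map (on ι) (map (injʳ a) L′)

  s′ : Sublist (ImageOf f) (map (injˡ n) (e ∷ E) ++ map (injʳ m) E′) (M ++ M′)
  s′ = subst (Sublist (ImageOf f) _) (map-++ (on ι) (map (injˡ b) L) _) s

  sˡ : Sublist (ImageOf (f ∘ (_↑ˡ n))) (e ∷ E) (M ++ M′)
  sˡ = map⁻ˡ (e ∷ E) (++-takeˡ (map (injˡ n) (e ∷ E)) s′)

  -- If `e` lands in the left summand, connectedness puts all vertices of its tree there, and
  -- `cancelʳ` leaves the copy in `L` that `¬copyˡ` excludes.
  not-left : ∀ {p} → p ∈ M → ¬ ImageOf f (injˡ n e) p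
  not-left p∈ r with ∈-map⁻ (on ι) p∈
  ... | _ , p∈ , refl with ∈-map⁻ (injˡ b) p∈
  ...   | _ , _ , refl with image-head {f = f ∘ (_↑ˡ n)} r
  ...     | i , fi≡ = ¬copyˡ (subst (Sublist _ _) (map-injˡ ι L)
    (cancelʳ M (λ { _ q∈ r′ → let j , fj≡ = image-head {f = f ∘ (_↑ˡ n)} r′ in ¬↑ˡ ι-inj L′ q∈
      (subst (λ u → ∃[ z ] u ≡ ι (z ↑ˡ b)) fj≡
        (spread {f = f ∘ (_↑ˡ n)} (closed-↑ˡ ι-inj L L′) sˡ (conn i j) (_ , fi≡))) }) sˡ))

-- Induction on `L`: `¬copy-⊕` handles an e₀ inside `L`, and once `L` is exhausted only edges of
-- `L′` remain. An edgeless `E` has no first edge for `¬copy-⊕`, hence the condition that `L` is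
-- then edgeless too.
blocked-⊕ : {E : List (Edge m)} {E′ : List (Edge n)} → (∀ i j → Star (Adj E) i j) →
  (L : List (Edge a)) → (E ≡ [] → L ≡ []) → Blocked E L → {L′ : List (Edge b)} →
  Blocked E′ L′ → Blocked (map (injˡ n) E ++ map (injʳ m) E′) (map (injˡ b) L ++ map (injʳ a) L′)
blocked-⊕ {E = E} _ [] _ _ {L′} bl′ = blocked-↑ʳ {E = E} L′ bl′
blocked-⊕ {E = []} conn (_ ∷ _) nonempty _ _ = case nonempty refl of λ ()
blocked-⊕ {n = n} {b = b} {E = E@(_ ∷ _)} conn (_ ∷ L) nonempty (blk , bl) bl′ =
  (λ ι-inj f-inj f≢x f≢y → ¬copy-⊕ conn L bl′ ι-inj f-inj
    (blk (↑ˡ-injective b _ _ ∘ ι-inj) (↑ˡ-injective n _ _ ∘ f-inj)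
      (λ i → f≢x (i ↑ˡ n)) (λ i → f≢y (i ↑ˡ n)))) ,
  blocked-⊕ conn L (λ ()) bl bl′

gadget-⊕ : {T : EdgeOrderedGraph m} {F : EdgeOrderedGraph n} → Connected T →
  (𝒯 : Gadget (edges T)) → (edges T ≡ [] → edges (Gadget.graph 𝒯) ≡ []) →
  Gadget (edges F) → Gadget (edges (T ⊕ F))
gadget-⊕ {m} {n} {T} {F} conn 𝒯 nonempty ℱ = record
  { graph    = 𝒯.graph ⊕ ℱ.graph
  ; root     = 𝒯.root ↑ˡ ℱ.order
  ; avoiding = λ u → copy (splitView 𝒯.order u)
  ; blocked  = blocked-⊕ conn (edges 𝒯.graph) nonempty 𝒯.blocked ℱ.blocked
  }
  where
  module 𝒯 = Gadget 𝒯
  module ℱ = Gadget ℱ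

  copy : ∀ {u} → SplitView 𝒯.order u → ∃[ f ] Inj f × (∀ i → f i ≢ u) ×
    Sublist (ImageOf f) (edges (T ⊕ F)) (edges (𝒯.graph ⊕ ℱ.graph))
  -- Only the summand containing `u` has to avoid it; in the other one any copy will do, such as the
  -- one avoiding its root.
  copy (left u) with 𝒯.avoiding u | ℱ.avoiding ℱ.root
  ... | f , f-inj , f≢u , s | g , g-inj , _ , t = parallel f g ,
    parallel-injective f g f-inj g-inj , parallel-avoidsˡ f g f≢u , parallel-Sublist f g s t
  copy (right u) with 𝒯.avoiding 𝒯.root | ℱ.avoiding u
  ... | f , f-inj , _ , s | g , g-inj , g≢u , t = parallel f g ,
    parallel-injective f g f-inj g-inj , parallel-avoidsʳ f g g≢u , parallel-Sublist f g s t

-- The gadget of a tree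

Blocked-all : {E : List (Edge v)} (L : List (Edge a)) →
  (∀ {n} {ι : Fin a → Fin n} {f : Fin v → Fin n} → Inj ι →
    ¬ Sublist (ImageOf f) E (map (on ι) L)) → Blocked E L
Blocked-all []      _     = tt
Blocked-all (p ∷ L) ¬copy =
  (λ ι-inj _ _ _ s → ¬copy ι-inj (_ ∷ʳ s)) ,
  Blocked-all L (λ ι-inj s → ¬copy ι-inj (_ ∷ʳ s))

-- Double counting: the members of `xs` are matched to distinct positions of `ys`, each of weight at
-- least 1. With weight 0 outside one contracted tree, this counts the edges of that tree.
length≤weight : ∀ {A B C : Set} {R : A → C → Set} {g : B → C} (weight : B → ℕ) →
  (∀ {x y} → R x (g y) → 1 ≤ weight y) →
  ∀ {xs} ys → Sublist R xs (map g ys) → length xs ≤ sum (map weight ys)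
length≤weight weight heavy []       []       = z≤n
length≤weight weight heavy (y ∷ ys) (_ ∷ʳ s) =
  ℕ.≤-trans (length≤weight weight heavy ys s) (ℕ.m≤n+m _ (weight y))
length≤weight weight heavy (y ∷ ys) (r ∷ s)  =
  ℕ.+-mono-≤ (heavy r) (length≤weight weight heavy ys s)

-- As the three versions of an edge are consecutive, the version can be chosen independently for
-- each edge without disturbing the order.
match-one : ∀ {A B : Set} {R : A → B → Set} (g : Fin 3 → B) c {x xs ys} → R x (g c) →
  Sublist R xs ys → Sublist R (x ∷ xs) (map g (allFin 3) ++ ys)
match-one g 0F r s = r ∷ g 1F ∷ʳ g 2F ∷ʳ s
match-one g 1F r s = g 0F ∷ʳ r ∷ g 2F ∷ʳ s
match-one g 2F r s = g 0F ∷ʳ g 1F ∷ʳ r ∷ s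

Unique-map : ∀ {A B : Set} (f : A → B) {xs} →
  (∀ {x y} → x ∈ xs → y ∈ xs → f x ≡ f y → x ≡ y) → Unique xs → Unique (map f xs)
Unique-map f inj []       = []
Unique-map f inj (x∉ ∷ u) =
  All.map⁺ (All.tabulate (λ y∈ eq → All.lookup x∉ y∈ (inj (here refl) (there y∈) eq))) ∷
  Unique-map f (λ x∈ y∈ → inj (there x∈) (there y∈)) u

orient : Edge n → Edge n
orient (i , j) with i <? j
... | yes _ = i , j
... | no  _ = j , i

orient-image : (e : Edge n) → orient e ≡ e ⊎ orient e ≡ (proj₂ e , proj₁ e)
orient-image (i , j) with i <? j
... | yes _ = inj₁ refl
... | no  _ = inj₂ refl

orient-ordered : (e : Edge n) → proj₁ e ≢ proj₂ e → Ordered (orient e)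
orient-ordered (i , j) i≢j with i <? j
... | yes i<j = i<j
... | no  i≮j = Fin.≤∧≢⇒< (ℕ.≮⇒≥ i≮j) (i≢j ∘ sym)

orient-≡ : (e e′ : Edge n) → orient e ≡ orient e′ → e ≡ e′ ⊎ e ≡ (proj₂ e′ , proj₁ e′)
orient-≡ e e′ eq with orient-image e | orient-image e′
... | inj₁ p | inj₁ q = inj₁ (trans (sym p) (trans eq q))
... | inj₁ p | inj₂ q = inj₂ (trans (sym p) (trans eq q))
... | inj₂ p | inj₁ q = inj₂ (cong (λ (i , j) → j , i) (trans (sym p) (trans eq q)))
... | inj₂ p | inj₂ q = inj₁ (cong (λ (i , j) → j , i) (trans (sym p) (trans eq q)))

-- The edge in position r is the one opposite to vertex r.
Δ : List (Edge 3)
Δ = (1F , 2F) ∷ (0F , 2F) ∷ (0F , 1F) ∷ []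

Δ-ordered : All Ordered Δ
Δ-ordered = s≤s (s≤s z≤n) ∷ s≤s z≤n ∷ s≤s z≤n ∷ []

Δ-unique : Unique Δ
Δ-unique = ((λ ()) ∷ (λ ()) ∷ []) ∷ ((λ ()) ∷ []) ∷ [] ∷ []

Δ-avoiding : ∀ r → ∃[ e ] e ∈ Δ × proj₁ e ≢ r × proj₂ e ≢ r
Δ-avoiding 0F = _ , here refl , (λ ()) , (λ ())
Δ-avoiding 1F = _ , there (here refl) , (λ ()) , (λ ())
Δ-avoiding 2F = _ , there (there (here refl)) , (λ ()) , (λ ())

-- side tells apart the two components of the tree T = xy ∷ E without its first
-- edge xy; at c embeds the vertices of T as the c-th copy.
module TreeGadget {x y : Fin m} {E : List (Edge m)}
  (at : Fin 3 → Fin m → Fin n)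
  (at-injective : ∀ {c i d j} → at c i ≡ at d j → c ≡ d × i ≡ j)
  (at-surjective : ∀ u → ∃[ c ] ∃[ i ] at c i ≡ u)
  (at-mono : ∀ {c d} i j → c < d → at c i < at d j)
  (ord : All Ordered E) (uniq : Unique E)
  (conn : ∀ i j → Star (Adj ((x , y) ∷ E)) i j)
  (side : Fin m → Bool) (sep : Separates E side) (side-x : side x ≡ false) (side-y : side y ≡ true)
  where

  -- The contraction keeps the vertex set of the tree: `y` is identified with `x`, and the old
  -- vertex `y` becomes isolated.
  merge : Fin m → Fin m
  merge z with z ≟ y
  ... | yes _ = x
  ... | no  _ = z

  merge-x : merge x ≡ x
  merge-x with x ≟ y
  ... | yes _ = refl
  ... | no  _ = refl

  merge-y : merge y ≡ x
  merge-y with y ≟ y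
  ... | yes _ = refl
  ... | no ¬p = contradiction refl ¬p

  sides-differ : side y ≢ side x
  sides-differ eq = case trans (sym side-y) (trans eq side-x) of λ ()

  -- The only collision is that of `x` with `y`, which lie on different sides.
  merge-≡ : ∀ {i j} → merge i ≡ merge j → i ≡ j ⊎ (merge i ≡ x × side i ≢ side j)
  merge-≡ {i} {j} eq with i ≟ y | j ≟ y
  ... | yes refl | yes refl = inj₁ refl
  ... | yes refl | no _     =
    inj₂ (refl , λ same → sides-differ (trans same (cong side (sym eq))))
  ... | no _     | yes refl =
    inj₂ (eq , λ same → sides-differ (trans (sym same) (cong side eq)))
  ... | no _     | no _     = inj₁ eq

  merge-injective : ∀ {i j} → side i ≡ side j → merge i ≡ merge j → i ≡ j
  merge-injective same eq with merge-≡ eq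
  ... | inj₁ i≡j          = i≡j
  ... | inj₂ (_ , differ) = contradiction same differ

  -- Contraction creates no parallel edges. Each edge stays within one side, so either both ends
  -- agree or both ends switch sides; in the latter case both would be merged into `x`, making a
  -- loop.
  merge-edge : ∀ {i j i′ j′} → side i ≡ side j → i ≢ j → side i′ ≡ side j′ →
    merge i ≡ merge i′ → merge j ≡ merge j′ → i ≡ i′ × j ≡ j′
  merge-edge s i≢j s′ eq eq′ with merge-≡ eq | merge-≡ eq′
  ... | inj₁ p | inj₁ q = p , q
  ... | inj₁ refl | inj₂ (_ , d) = contradiction (trans (sym s) s′) d
  ... | inj₂ (_ , d) | inj₁ refl = contradiction (trans s (sym s′)) d
  ... | inj₂ (p , _) | inj₂ (q , _) =
    contradiction (merge-injective s (trans p (sym q))) i≢j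

  root : Fin 3 → Fin n
  root c = at c x

  root-injective : ∀ {c d} → root c ≡ root d → c ≡ d
  root-injective eq = proj₁ (at-injective eq)

  -- Replacing `y` by `x` may reverse the order of the ends, which `orient` repairs.
  contract : Edge m × Fin 3 → Edge n
  contract (e , c) = orient (on (at c ∘ merge) e)

  Es : List (Edge m × Fin 3)
  Es = cartesianProduct E (allFin 3)

  X : List (Edge n)
  X = map contract Es

  Es-edge : ∀ {e c} → (e , c) ∈ Es → e ∈ E
  Es-edge p = proj₁ (∈-cartesianProduct⁻ E (allFin 3) p)

  E-loopless : ∀ {i j} → (i , j) ∈ E → i ≢ j
  E-loopless e∈ = Fin.<⇒≢ (All.lookup ord e∈)

  contract-ordered : ∀ {p} → p ∈ Es → Ordered (contract p)
  contract-ordered p∈ = orient-ordered _ λ eq → E-loopless (Es-edge p∈)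
    (merge-injective (All.lookup sep (Es-edge p∈)) (proj₂ (at-injective eq)))

  contract-injective : ∀ {p q} → p ∈ Es → q ∈ Es → contract p ≡ contract q → p ≡ q
  contract-injective {(i , j) , c} {(i′ , j′) , c′} p∈ q∈ eq
    with All.lookup sep (Es-edge p∈) | All.lookup sep (Es-edge q∈)
       | orient-≡ (on (at c ∘ merge) (i , j)) (on (at c′ ∘ merge) (i′ , j′)) eq
  ... | s | s′ | inj₁ eq′
    with refl , mi ← at-injective (cong proj₁ eq′)
    with _ , mj ← at-injective (cong proj₂ eq′)
    with refl , refl ← merge-edge s (E-loopless (Es-edge p∈)) s′ mi mj = refl
  -- A coincidence with reversed ends would put both an edge and its reversal into `E`.
  ... | s | s′ | inj₂ eq′
    with refl , mi ← at-injective (cong proj₁ eq′)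
    with _ , mj ← at-injective (cong proj₂ eq′)
    with refl , refl ← merge-edge s (E-loopless (Es-edge p∈)) (sym s′) mi mj =
    contradiction (All.lookup ord (Es-edge p∈)) (Fin.<-asym (All.lookup ord (Es-edge q∈)))

  contract-ends : ∀ e c → ∃[ i ] ∃[ j ] contract (e , c) ≡ (at c i , at c j)
  contract-ends e c with orient-image (on (at c ∘ merge) e)
  ... | inj₁ eq = _ , _ , eq
  ... | inj₂ eq = _ , _ , eq

  triangle : List (Edge n)
  triangle = map (on root) Δ

  graph : EdgeOrderedGraph n
  graph = mkGraph (triangle ++ X)
    (All.++⁺ (All.map⁺ (All.map (at-mono x x) Δ-ordered))
             (All.map⁺ (All.tabulate contract-ordered)))
    (Unique.++⁺
      (Unique.map⁺ (λ eq → cong₂ _,_ (root-injective (cong proj₁ eq))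
                                     (root-injective (cong proj₂ eq))) Δ-unique)
      (Unique-map contract contract-injective
        (Unique.cartesianProduct⁺ uniq (Unique.allFin⁺ 3)))
      disjoint)
    where
    -- Triangle edges join different copies, whereas contracted edges stay within one.
    disjoint : ∀ {e} → ¬ (e ∈ triangle × e ∈ X)
    disjoint (p , q) with ∈-map⁻ (on root) p | ∈-map⁻ contract q
    ... | (c , d) , cd∈ , refl | (e , r) , _ , eq with contract-ends e r
    ...   | i , j , eq′ = Fin.<⇒≢ (All.lookup Δ-ordered cd∈) (trans
      (proj₁ (at-injective (cong proj₁ (trans eq eq′))))
      (sym (proj₁ (at-injective (cong proj₂ (trans eq eq′))))))

  module _ (c d : Fin 3) where

    pick : Bool → Fin 3
    pick s = if s then d else c

    -- This undoes the contraction: `x` and `y` go to the roots of two different copies when `c` and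
    -- `d` differ.
    place : Fin m → Fin n
    place z = at (pick (side z)) (merge z)

    -- Vertices placed in the same copy come from the same side, and there `merge` is injective.
    place-injective : c ≢ d → Inj place
    place-injective c≢d {i} {j} eq
      with pq , mq ← at-injective eq =
      merge-injective (pick-injective _ _ pq) mq
      where
      pick-injective : ∀ s t → pick s ≡ pick t → s ≡ t
      pick-injective false false _  = refl
      pick-injective false true  eq = contradiction eq c≢d
      pick-injective true  false eq = contradiction (sym eq) c≢d
      pick-injective true  true  _  = refl

    place-avoids : ∀ {r u} → c ≢ r → d ≢ r → ∀ z → place z ≢ at r u
    place-avoids {r} c≢r d≢r z eq = pick≢ (side z) (proj₁ (at-injective eq))
      where
      pick≢ : ∀ s → pick s ≢ r
      pick≢ false = c≢r
      pick≢ true  = d≢r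

    place-edge : ∀ e → side (proj₁ e) ≡ side (proj₂ e) →
      ImageOf place e (contract (e , pick (side (proj₁ e))))
    place-edge e s with orient-image (on (at (pick (side (proj₁ e))) ∘ merge) e)
    ... | inj₁ eq rewrite sym s = inj₁ eq
    ... | inj₂ eq rewrite sym s = inj₂ eq

    place-root : ImageOf place (x , y) (root c , root d)
    place-root = inj₁ (sym (cong₂ _,_
      (cong₂ (at ∘ pick) side-x merge-x) (cong₂ (at ∘ pick) side-y merge-y)))

    place-contract : ∀ {E} → Separates E side →
      Sublist (ImageOf place) E (map contract (cartesianProduct E (allFin 3)))
    place-contract []            = []
    place-contract {e ∷ E} (s ∷ ss) =
      match-one (λ c → contract (e , c)) (pick (side (proj₁ e))) (place-edge e s)
        (place-contract ss)

    place-tree : (c , d) ∈ Δ → Sublist (ImageOf place) ((x , y) ∷ E) (triangle ++ X)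
    place-tree cd∈ = Sublist.++⁺
      (Sublist.fromAny (Any.map (λ { refl → place-root }) (∈-map⁺ (on root) cd∈)))
      (place-contract sep)

  avoiding : ∀ u → ∃[ f ] Inj f × (∀ z → f z ≢ u) ×
    Sublist (ImageOf f) ((x , y) ∷ E) (triangle ++ X)
  avoiding u with at-surjective u
  ... | r , z , refl with Δ-avoiding r
  ...   | (c , d) , cd∈ , c≢r , d≢r =
    place c d , place-injective c d (Fin.<⇒≢ (All.lookup Δ-ordered cd∈)) ,
    place-avoids c d c≢r d≢r , place-tree c d cd∈

  module _ {ι : Fin n → Fin k} (ι-inj : Inj ι) where

    InCopy : Fin 3 → Fin k → Set
    InCopy c u = ∃[ z ] u ≡ ι (at c z)

    InCopy-unique : ∀ {c d z} → InCopy c (ι (at d z)) → c ≡ d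
    InCopy-unique {c} {d} {z} (z′ , eq) = proj₁ (at-injective (sym (ι-inj eq)))

    InCopy-closed : ∀ c → Closed (map (on ι) X) (InCopy c)
    InCopy-closed c e∈ with ∈-map⁻ (on ι) e∈
    ... | _ , e∈ , refl with ∈-map⁻ contract e∈
    ...   | (e , d) , _ , refl with contract-ends e d
    ...     | _ , _ , eq rewrite eq =
      (λ q → case InCopy-unique q of λ { refl → _ , refl }) ,
      (λ q → case InCopy-unique q of λ { refl → _ , refl })

    weight : Fin 3 → Fin 3 → ℕ
    weight c d = if does (c ≟ d) then 1 else 0

    total-weight : ∀ c (E : List (Edge m)) →
      sum (map (weight c ∘ proj₂) (cartesianProduct E (allFin 3))) ≡ length E
    total-weight c  []      = refl
    total-weight 0F (_ ∷ E) = cong ℕ.suc (total-weight 0F E)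
    total-weight 1F (_ ∷ E) = cong ℕ.suc (total-weight 1F E)
    total-weight 2F (_ ∷ E) = cong ℕ.suc (total-weight 2F E)

    -- Connectedness confines a copy to the contracted tree `c` that receives its first edge. The
    -- weights total `length E` there, one less than the number of edges of the tree.
    ¬copy : {f : Fin m → Fin k} → ¬ Sublist (ImageOf f) ((x , y) ∷ E) (map (on ι) X)
    ¬copy {f} s with find (lookup∈ (here refl) s)
    ... | _ , e∈ , r with ∈-map⁻ (on ι) e∈
    ... | _ , e∈ , refl with ∈-map⁻ contract e∈
    ... | (e , c) , _ , refl with contract-ends e c
    ... | _ , _ , eq with image-head {f = f} r
    ... | i , fi≡ = ℕ.1+n≰n (subst (ℕ.suc (length E) ≤_) (total-weight c E)
      (length≤weight (weight c ∘ proj₂) (λ {p} {q} → heavy {p} {q}) Es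
        (subst (Sublist (ImageOf f) _) (sym (map-∘ Es)) s)))
      where
      all-in : ∀ j → InCopy c (f j)
      all-in j = spread (InCopy-closed c) s (conn i j)
        (subst (InCopy c) (sym fi≡) (_ , cong (ι ∘ proj₁) eq))

      heavy : ∀ {p q} → ImageOf f p (on ι (contract q)) → 1 ≤ weight c (proj₂ q)
      heavy {q = e , d} r with c ≟ d
      ... | yes _ = s≤s z≤n
      ... | no c≢d with image-head {f = f} r | contract-ends e d
      ...   | j , fj≡ | _ , _ , eq = contradiction
        (InCopy-unique (subst (InCopy c) (trans fj≡ (cong (ι ∘ proj₁) eq)) (all-in j))) c≢d

  -- It suffices to see where the first edge of the copy goes: a later triangle edge shares a root
  -- with e₀, and otherwise the whole copy lies in `X`.
  blocked : Blocked ((x , y) ∷ E) (triangle ++ X)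
  blocked =
    (λ {_} {ι} {f} ι-inj _ f≢1 f≢2 → λ
      { (_ ∷ʳ _ ∷ʳ s) → ¬copy ι-inj s
      ; (_ ∷ʳ r ∷ _)  → let i , eq = image-tail {f = f} r in f≢1 i eq
      ; (r ∷ _)       → let i , eq = image-tail {f = f} r in f≢2 i eq }) ,
    (λ {_} {ι} {f} ι-inj _ f≢0 f≢2 → λ
      { (_ ∷ʳ s) → ¬copy ι-inj s
      ; (r ∷ _)  → let i , eq = image-head {f = f} r in f≢0 i eq }) ,
    (λ ι-inj _ _ _ → ¬copy ι-inj) ,
    Blocked-all X (λ ι-inj → ¬copy ι-inj)

gadget-tree : (T : EdgeOrderedGraph m) → IsTree T →
  Σ[ 𝒯 ∈ Gadget (edges T) ] (edges T ≡ [] → edges (Gadget.graph 𝒯) ≡ [])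
-- For a tree without edges, three disjoint copies of its vertex set suffice: some copy misses the
-- given vertex.
gadget-tree {m} (mkGraph [] _ _) tree = record
  { order = 3 * m
  ; graph = mkGraph [] [] []
  ; root = combine {3} 0F (fromℕ< (IsTree.nonempty tree))
  ; avoiding = λ u → case combine-surjective {3} {m} u of λ
      { (0F , _ , refl) → avoid 1F 0F (λ ())
      ; (1F , _ , refl) → avoid 0F 1F (λ ())
      ; (2F , _ , refl) → avoid 0F 2F (λ ()) }
  ; blocked = tt
  } , λ _ → refl
  where
  avoid : ∀ c d {u} → c ≢ d → ∃[ f ] Inj f × (∀ i → f i ≢ combine {3} {m} d u) ×
    Sublist (ImageOf {m} f) [] []
  avoid c d c≢d = combine c , combine-injectiveʳ c _ c _ ,
    (λ i eq → c≢d (combine-injectiveˡ c i d _ eq)) , []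
gadget-tree {m} (mkGraph ((x , y) ∷ E) (x<y ∷ ord) (e∉ ∷ uniq)) tree
  with connected-or-separated E x y
... | inj₁ x~y = contradiction x~y (acyclic⇒bridge (IsTree.acyclic tree))
... | inj₂ (side , sep , sx , sy) = record
  { graph = graph
  ; root = root 0F
  ; avoiding = avoiding
  ; blocked = blocked
  } , λ ()
  where
  -- `combine` lays out the three copies as successive blocks of vertices, so the triangle edges
  -- inherit their orientation from `Δ`.
  open TreeGadget combine
    (λ {c} {i} {d} {j} → combine-injective c i d j) combine-surjective combine-monoˡ-<
    ord uniq (IsTree.connected tree) side sep sx sy

-- Saturation

image-∘ : ∀ {f : Fin m → Fin n} {g : Fin n → Fin k} {e e′ e″} →
  ImageOf f e e′ → ImageOf g e′ e″ → ImageOf (g ∘ f) e e″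
image-∘ (inj₁ refl) r = r
image-∘ (inj₂ refl) r = Sum.swap r

map⁺ˡ : ∀ {A B C : Set} {R : B → C → Set} {f : A → B} {xs ys} →
  Sublist (R ∘ f) xs ys → Sublist R (map f xs) ys
map⁺ˡ []       = []
map⁺ˡ (y ∷ʳ s) = y ∷ʳ map⁺ˡ s
map⁺ˡ (r ∷ s)  = r ∷ map⁺ˡ s

-- The gadget itself is unchanged. Copies of `G` become copies of `F` through `φ`, and copies of `F`
-- to be excluded become copies of `G` through its inverse `ψ`.
gadget-≅ : {F : EdgeOrderedGraph m} {G : EdgeOrderedGraph n} → F ≅ G →
  Gadget (edges G) → Gadget (edges F)
gadget-≅ {m} {n} {F} {G} (φ , (φ-inj , φ-surj) , p) 𝒢 = record
  { graph = 𝒢.graph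
  ; root = 𝒢.root
  ; avoiding = λ u → let f , f-inj , f≢u , s = 𝒢.avoiding u in
      f ∘ φ , φ-inj ∘ f-inj , f≢u ∘ φ , compose f p s
  ; blocked = unblock (edges 𝒢.graph) 𝒢.blocked
  }
  where
  module 𝒢 = Gadget 𝒢

  compose : ∀ (f : Fin n → Fin k) {E E′ L} → Pointwise (ImageOf φ) E E′ →
    Sublist (ImageOf f) E′ L → Sublist (ImageOf (f ∘ φ)) E L
  compose f []      s        = minimum _
  compose f (q ∷ qs) (_ ∷ʳ s) = _ ∷ʳ compose f (q ∷ qs) s
  compose f (q ∷ qs) (r ∷ s)  = image-∘ {f = φ} {f} q r ∷ compose f qs s

  ψ : Fin n → Fin m
  ψ j = proj₁ (φ-surj j)

  φψ : ∀ j → φ (ψ j) ≡ j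
  φψ j = proj₂ (φ-surj j) refl

  ψφ : ∀ i → ψ (φ i) ≡ i
  ψφ i = φ-inj (φψ (φ i))

  ψ-inj : Inj ψ
  ψ-inj {i} {j} eq = trans (sym (φψ i)) (trans (cong φ eq) (φψ j))

  inverse : ∀ {f : Fin m → Fin k} {E E′ L} → Pointwise (ImageOf φ) E E′ →
    Sublist (ImageOf f) E L → Sublist (ImageOf (f ∘ ψ)) E′ L
  inverse [] s = minimum _
  inverse (q ∷ qs) (_ ∷ʳ s) = _ ∷ʳ inverse (q ∷ qs) s
  inverse {f = f} (inj₁ refl ∷ qs) (r ∷ s) =
    subst₂ (λ i j → ImageOf f (i , j) _) (sym (ψφ _)) (sym (ψφ _)) r ∷ inverse qs s
  inverse {f = f} (inj₂ refl ∷ qs) (r ∷ s) =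
    subst₂ (λ i j → ImageOf f (i , j) _) (sym (ψφ _)) (sym (ψφ _)) (Sum.swap r) ∷ inverse qs s

  unblock : (L : List (Edge a)) → Blocked (edges G) L → Blocked (edges F) L
  unblock []      _        = tt
  unblock (_ ∷ L) (blk , bl) =
    (λ ι-inj f-inj f≢x f≢y s → blk ι-inj (ψ-inj ∘ f-inj) (f≢x ∘ ψ) (f≢y ∘ ψ) (inverse p s)) ,
    unblock L bl

gadget-⨁ : ∀ Ts → All (IsTree ∘ proj₂) Ts → Gadget (edges (⨁ Ts))
-- The empty forest gets one isolated vertex, which provides the root.
gadget-⨁ [] [] = record
  { graph = mkGraph {1} [] [] []
  ; root = zero
  ; avoiding = λ _ → (λ ()) , (λ { {()} }) , (λ ()) , []
  ; blocked = tt
  }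
gadget-⨁ ((_ , T) ∷ Ts) (tree ∷ trees) = let 𝒯 , nonempty = gadget-tree T tree in
  gadget-⊕ {T = T} {⨁ Ts} (IsTree.connected tree) 𝒯 nonempty (gadget-⨁ Ts trees)

-- Existence of the minimum by finite search

least : {P : ℕ → Set} → Decidable P → ∀ n → P n → ∃[ s ] s ≤ n × P s × (∀ t → P t → s ≤ t)
least P? ℕ.zero p = 0 , z≤n , p , λ _ _ → z≤n
least P? (ℕ.suc n) p with P? 0
... | yes p₀ = 0 , z≤n , p₀ , λ _ _ → z≤n
... | no ¬p₀ with least (P? ∘ ℕ.suc) n p
...   | s , s≤n , ps , minimal = ℕ.suc s , s≤s s≤n , ps , λ
  { ℕ.zero p₀ → contradiction p₀ ¬p₀ ; (ℕ.suc t) pt → s≤s (minimal t pt) }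

Searchable : Set → Set₁
Searchable A = {P : A → Set} → Decidable P → Dec (∃ P)

search-× : {A B : Set} → Searchable A → Searchable B → Searchable (A × B)
search-× searchA searchB P? =
  map′ (λ (x , y , p) → (x , y) , p) (λ ((x , y) , p) → x , y , p)
    (searchA λ x → searchB λ y → P? (x , y))

search-Vec : {A : Set} → Searchable A → ∀ n → Searchable (Vec A n)
search-Vec search ℕ.zero    P? = map′ ([] ,_) (λ { ([] , p) → p }) (P? [])
search-Vec search (ℕ.suc n) P? =
  map′ (λ (x , xs , p) → x ∷ xs , p) (λ { (x ∷ xs , p) → x , xs , p })
    (search λ x → search-Vec search n λ xs → P? (x ∷ xs))

_≟ᴱ_ : DecidableEquality (Edge n)
_≟ᴱ_ = ≡-dec _≟_ _≟_

image? : (f : Fin m → Fin n) → ∀ e e′ → Dec (ImageOf f e e′)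
image? f (i , j) e′ = (e′ ≟ᴱ (f i , f j)) ⊎-dec (e′ ≟ᴱ (f j , f i))

injective? : (f : Fin m → Fin n) → Dec (Inj f)
injective? f = map′ (λ inj {i} {j} → inj i j) (λ inj i j → inj {i} {j})
  (Fin.all? λ i → Fin.all? λ j → (f i ≟ f j) →-dec (i ≟ j))

image-cong : {f g : Fin m → Fin n} → (∀ i → f i ≡ g i) →
  ∀ {e e′} → ImageOf f e e′ → ImageOf g e e′
image-cong f≗g {i , j} rewrite f≗g i | f≗g j = λ r → r

-- Vertex maps are searched through their tables of values; `image-cong` carries a copy from a map
-- to its table.
contains? : (H : EdgeOrderedGraph n) (G : EdgeOrderedGraph m) → Dec (Contains H G)
contains? {n} {m} H G = map′
  (λ (v , inj , s) → lookup v , (λ {i} {j} → inj {i} {j}) , s)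
  (λ (f , inj , s) → tabulate f ,
    (λ {i} {j} eq → inj (trans (sym (lookup∘tabulate f i)) (trans eq (lookup∘tabulate f j)))) ,
    Sublist.map (image-cong (λ i → sym (lookup∘tabulate f i))) s)
  (search-Vec Fin.any? m λ v →
    injective? (lookup v) ×-dec Sublist.sublist? (image? (lookup v)) (edges G) (edges H))

saturated? : (G : EdgeOrderedGraph m) (H : EdgeOrderedGraph n) → Dec (MonotoneSaturated G H)
saturated? G H = map′
  (λ (fr , sat) → record { free = fr ; saturated = λ (i , j) → sat i j })
  (λ ms → MonotoneSaturated.free ms , λ i j → MonotoneSaturated.saturated ms (i , j))
  (¬? (contains? H G) ×-dec Fin.all? λ i → Fin.all? λ j → sat? (i , j))
  where
  open DecMembership _≟ᴱ_ using (_∈?_)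

  sat? : ∀ e → Dec (∀ e< e∉ → Contains (addFirst H e e< e∉) G)
  sat? e@(i , j) with i <? j | e ∈? edges H
  ... | no i≮j | _      = yes λ i<j → contradiction i<j i≮j
  ... | yes _  | yes e∈ = yes λ _ e∉ → contradiction e∈ e∉
  ... | yes i<j | no e∉ = map′ (λ c _ _ → c) (λ h → h i<j e∉) (contains? (addFirst H e i<j e∉) G)

-- With the number of edges fixed, only finitely many edge lists are to be tested. This makes
-- `least` applicable, so that the minimum is attained.
ofSize? : ∀ n (G : EdgeOrderedGraph m) →
  Decidable (λ s → Σ[ H ∈ EdgeOrderedGraph n ] MonotoneSaturated G H × size H ≡ s)
ofSize? n G s = map′
  (λ (es , ord , uniq , ms) → mkGraph (toList es) ord uniq , ms , length-toList es)
  (λ { (mkGraph L ord uniq , ms , refl) → fromList L ,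
    subst Valid (sym (toList∘fromList L)) (ord , uniq , ms) })
  (search-Vec (search-× Fin.any? Fin.any?) s (valid? ∘ toList))
  where
  Valid : List (Edge n) → Set
  Valid L = Σ[ ord ∈ All Ordered L ] Σ[ uniq ∈ Unique L ]
    MonotoneSaturated G (mkGraph L ord uniq)

  valid? : (L : List (Edge n)) → Dec (Valid L)
  valid? L with All.all? (λ (i , j) → i <? j) L | DecUnique.unique? _≟ᴱ_ L
  ... | no ¬ord | _         = no λ (ord , _) → ¬ord ord
  ... | yes _   | no ¬uniq  = no λ (_ , uniq , _) → ¬uniq uniq
  ... | yes ord | yes uniq  = map′ (λ ms → ord , uniq , ms)
    -- Saturation speaks of the edge list only, so it transfers to other proofs of orderedness and
    -- uniqueness.
    (λ (_ , _ , ms) → record { free = MonotoneSaturated.free ms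
                             ; saturated = λ e e< e∉ → MonotoneSaturated.saturated ms e e< e∉ })
    (saturated? G (mkGraph L ord uniq))

-- Greedy extension

CopyAvoiding : List (Edge v) → List (Edge n) → Edge n → Set
CopyAvoiding {v} {n} E L (x , y) = Σ[ f ∈ (Fin v → Fin n) ] Inj f ×
  (∀ i → f i ≢ x) × (∀ i → f i ≢ y) × Sublist (ImageOf f) E L

module _ (F : EdgeOrderedGraph v) where

  -- This persistence is why a single greedy pass suffices: a rejected edge stays rejected as
  -- further edges are put in front.
  copy-++ : ∀ (L′ : List (Edge n)) {L e} →
    CopyAvoiding (edges F) L e → CopyAvoiding (edges F) (L′ ++ L) e
  copy-++ L′ (f , f-inj , f≢x , f≢y , s) = f , f-inj , f≢x , f≢y , Sublist.++ˡ L′ s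

  -- As `H` is free, the copy must use the new edge, which comes first in the order and hence plays
  -- e₀.
  contains⇒copy : (H : EdgeOrderedGraph n) → ¬ Contains H (e₀+ F) → ∀ {e e<} {e∉ : e ∉ edges H} →
    Contains (addFirst H e e< e∉) (e₀+ F) → CopyAvoiding (edges F) (edges H) e
  contains⇒copy H free (f , f-inj , _ ∷ʳ s) = contradiction (f , (λ {_} {_} → f-inj) , s) free
  contains⇒copy H free (f , f-inj , r ∷ s) = f ∘ (2 ↑ʳ_) , ↑ʳ-injective 2 _ _ ∘ f-inj ,
    avoid₁ r , avoid₂ r , map⁻ˡ (edges F) s
    where
    avoid₁ : ∀ {e} → ImageOf f (zero , suc zero) e → ∀ i → f (2 ↑ʳ i) ≢ proj₁ e
    avoid₁ (inj₁ refl) i eq = case f-inj eq of λ ()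
    avoid₁ (inj₂ refl) i eq = case f-inj eq of λ ()

    avoid₂ : ∀ {e} → ImageOf f (zero , suc zero) e → ∀ i → f (2 ↑ʳ i) ≢ proj₂ e
    avoid₂ (inj₁ refl) i eq = case f-inj eq of λ ()
    avoid₂ (inj₂ refl) i eq = case f-inj eq of λ ()

  copy⇒contains : (H : EdgeOrderedGraph n) → ∀ {e} e< (e∉ : e ∉ edges H) →
    CopyAvoiding (edges F) (edges H) e → Contains (addFirst H e e< e∉) (e₀+ F)
  copy⇒contains {n} H {x , y} x<y _ (f , f-inj , f≢x , f≢y , s) =
    g , g-inj , inj₁ refl ∷ map⁺ˡ s
    where
    g : Fin (2 + v) → Fin n
    g zero          = x
    g (suc zero)    = y
    g (suc (suc i)) = f i

    g-inj : Inj g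
    g-inj {zero}        {zero}        _  = refl
    g-inj {zero}        {suc zero}    eq = contradiction eq (Fin.<⇒≢ x<y)
    g-inj {zero}        {suc (suc j)} eq = contradiction (sym eq) (f≢x j)
    g-inj {suc zero}    {zero}        eq = contradiction (sym eq) (Fin.<⇒≢ x<y)
    g-inj {suc zero}    {suc zero}    _  = refl
    g-inj {suc zero}    {suc (suc j)} eq = contradiction (sym eq) (f≢y j)
    g-inj {suc (suc i)} {zero}        eq = contradiction eq (f≢x i)
    g-inj {suc (suc i)} {suc zero}    eq = contradiction eq (f≢y i)
    g-inj {suc (suc i)} {suc (suc j)} eq = cong (2 ↑ʳ_) (f-inj eq)

  Extension : List (Edge n) → EdgeOrderedGraph n → Set
  Extension {n} es H = Σ[ H′ ∈ EdgeOrderedGraph n ]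
    ¬ Contains H′ (e₀+ F) × size H′ ≤ length es + size H ×
    (∃[ L ] edges H′ ≡ L ++ edges H) ×
    (∀ {e} → e ∈ es → Ordered e → e ∉ edges H′ → CopyAvoiding (edges F) (edges H′) e)

  -- Each edge of `es` is put in front unless this creates a copy of `e₀+ F`; in that case
  -- `contains⇒copy` records the reason. At most one edge is added per member of `es`.
  extend : (es : List (Edge n)) (H : EdgeOrderedGraph n) → ¬ Contains H (e₀+ F) →
    Extension es H
  extend [] H free = H , free , ℕ.≤-refl , ([] , refl) , λ ()
  extend {n} (e@(i , j) ∷ es) H free with extend es H free
  ... | H₁ , free₁ , size₁ , (L , eq) , copy₁ = insert
    where
    open DecMembership (_≟ᴱ_ {n}) using (_∈?_)

    keep : (Ordered e → e ∉ edges H₁ → CopyAvoiding (edges F) (edges H₁) e) → Extension (e ∷ es) H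
    keep copy = H₁ , free₁ , ℕ.m≤n⇒m≤1+n size₁ , (L , eq) , λ
      { (here refl) → copy ; (there e′∈) → copy₁ e′∈ }

    insert : Extension (e ∷ es) H
    insert with i <? j | e ∈? edges H₁
    ... | no i≮j | _ = keep λ i<j → contradiction i<j i≮j
    ... | yes _ | yes e∈ = keep λ _ e∉ → contradiction e∈ e∉
    ... | yes i<j | no e∉ with contains? (addFirst H₁ e i<j e∉) (e₀+ F)
    ...   | yes c  = keep λ _ _ → contains⇒copy H₁ free₁ {e< = i<j} {e∉} c
    ...   | no ¬c = addFirst H₁ e i<j e∉ , ¬c , s≤s size₁ , (e ∷ L , cong (e ∷_) eq) , λ
      { (here refl) _ e∉′ → contradiction (here refl) e∉′
      ; (there e′∈) e′< e′∉ → copy-++ (e ∷ []) (copy₁ e′∈ e′< (e′∉ ∘ there)) }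

-- Padding with isolated vertices

module _ (F : EdgeOrderedGraph v) (𝒢 : Gadget (edges F)) where

  open Gadget 𝒢

  candidates : List (Edge order)
  candidates = cartesianProduct (allFin order) (allFin order)

  -- New edges are sought only among pairs of gadget vertices, so the bound does not depend on the
  -- number `k` of isolated vertices.
  bound : ℕ
  bound = length candidates + size graph

  module _ (k : ℕ) where

    padded : EdgeOrderedGraph (order + k)
    padded = graph ⊕ mkGraph {k} [] [] []

    padded-edges : edges padded ≡ map (injˡ k) (edges graph)
    padded-edges = ++-identityʳ _

    padded-free : ¬ Contains padded (e₀+ F)
    padded-free (f , f-inj , s) = blocked⇒¬copy (edges graph) blocked
      (↑ˡ-injective k _ _) f-inj (↑ʳ-injective 2 _ _) [] (λ _ ()) (λ _ ())
      (subst (Sublist (ImageOf f) _) padded-edges s)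

    -- An edge not inside the gadget meets it in at most one vertex `u`, so a copy of `F` in the
    -- gadget that avoids `u` avoids both ends.
    data AtOrOutside (u : Fin order) : Fin (order + k) → Set where
      at      : AtOrOutside u (u ↑ˡ k)
      outside : ∀ j → AtOrOutside u (order ↑ʳ j)

    padded-copy : ∀ u {x y} → AtOrOutside u x → AtOrOutside u y →
      CopyAvoiding (edges F) (edges padded) (x , y)
    padded-copy u x-out y-out with avoiding u
    ... | f , f-inj , f≢u , s = (_↑ˡ k) ∘ f , f-inj ∘ ↑ˡ-injective k _ _ ,
      avoid x-out , avoid y-out ,
      subst (Sublist _ (edges F)) (sym padded-edges) (Sublist-on (_↑ˡ k) s)
      where
      avoid : ∀ {x} → AtOrOutside u x → ∀ i → f i ↑ˡ k ≢ x
      avoid at          i eq = f≢u i (↑ˡ-injective k _ _ eq)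
      avoid (outside j) i    = ↑ˡ≢↑ʳ (f i) j

    saturated-graph : Σ[ H ∈ EdgeOrderedGraph (order + k) ]
      MonotoneSaturated (e₀+ F) H × size H ≤ bound
    saturated-graph with extend F (map (injˡ k) candidates) padded padded-free
    ... | H , free , size≤ , (L , eq) , copy =
      H , record { free = free ; saturated = saturated } ,
      subst (size H ≤_) (cong₂ _+_ (length-map _ candidates)
        (trans (cong length padded-edges) (length-map _ (edges graph)))) size≤
      where
      old-copy : ∀ u {x y} → AtOrOutside u x → AtOrOutside u y →
        CopyAvoiding (edges F) (edges H) (x , y)
      old-copy u x-out y-out =
        subst (λ L → CopyAvoiding (edges F) L _) (sym eq) (copy-++ F L (padded-copy u x-out y-out))

      saturated : ∀ e e< (e∉ : e ∉ edges H) → Contains (addFirst H e e< e∉) (e₀+ F)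
      saturated (x , y) x<y e∉ = copy⇒contains F H x<y e∉
        (find-copy (splitView order x) (splitView order y) x<y e∉)
        where
        find-copy : ∀ {x y} → SplitView order x → SplitView order y → x < y → (x , y) ∉ edges H →
          CopyAvoiding (edges F) (edges H) (x , y)
        -- A pair inside the gadget is a candidate and was settled by the greedy pass.
        find-copy (left i)  (left j)  = copy
          (∈-map⁺ (injˡ k) (∈-cartesianProduct⁺ (∈-allFin i) (∈-allFin j)))
        find-copy (left i)  (right j) = λ _ _ → old-copy i at (outside j)
        find-copy (right i) (left j)  = λ _ _ → old-copy j (outside i) at
        -- Neither end is in the gadget, so any gadget vertex can serve as `u`.
        find-copy (right i) (right j) = λ _ _ → old-copy root (outside i) (outside j)

satₘ-bounded : (F : EdgeOrderedGraph v) → Gadget (edges F) → (λ n → Satₘ n (e₀+ F)) isO[1]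
-- The threshold is the order of the gadget: from there on, `n` is the order plus some number of
-- isolated vertices.
satₘ-bounded F 𝒢 = bound F 𝒢 , Gadget.order 𝒢 , bounded
  where
  bounded : ∀ n → Gadget.order 𝒢 ≤ n → ∃[ s ] Satₘ n (e₀+ F) s × s ≤ bound F 𝒢
  bounded n N≤n with ℕ.m≤n⇒∃[o]m+o≡n N≤n
  ... | k , refl with saturated-graph F 𝒢 k
  ...   | H , sat , size≤ with least (ofSize? n (e₀+ F)) (size H) (H , sat , refl)
  ...     | s , s≤ , attained , minimal = s ,
    record { attained = attained ; minimal = λ H′ sat′ → minimal _ (H′ , sat′ , refl) } ,
    ℕ.≤-trans s≤ size≤

corollary49 : ∀ {v : ℕ} (F : EdgeOrderedGraph v) → IsMonotoneForest F →
    (λ n → Satₘ n (e₀+ F)) isO[1]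
corollary49 F (Ts , trees , F≅⨁Ts) =
  satₘ-bounded F (gadget-≅ {F = F} {⨁ Ts} F≅⨁Ts (gadget-⨁ Ts trees))
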